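{- Let $k \geqslant 2$ be a fixed integer. There exists $n_0 = n_0(k)$ such that for every integer $n \geqslant n_0$ and every positive integer $q$ the following hold for the $(1:q)$ Client--Waiter $k$--SAT game played on the set $\mathcal{C}^{(k)}_n$ of all $k$--clauses over $n$ boolean variables. (i) If $q < \binom{n}{k}/n$, then Client has a strategy ensuring that the conjunction of all $k$--clauses he claims by the end of the game is not satisfiable. (ii) If $q \geqslant 16k^3\binom{n}{k}/n$, then Waiter has a strategy ensuring that the conjunction of all $k$--clauses claimed by Client is satisfiable throughout the game.
   Context: Fix boolean variables $x_1,\ldots,x_n$. A literal is a variable $x_i$ or its negation $\neg x_i$. A $k$--clause is the disjunction of exactly $k$ non--complementary literals, i.e. of $k$ literals belonging to $k$ distinct variables (clauses are identified with their sets of literals). $\mathcal{C}^{(k)}_n$ denotes the set of all $2^k\binom{n}{k}$ possible $k$--clauses over $x_1,\ldots,x_n$. A conjunction of $k$--clauses is satisfiable if some $\{0,1\}$--assignment to the variables makes every clause true. The $(1:q)$ Client--Waiter game $(X,\mathcal{F})$, where $X$ is a finite set (the board), $\mathcal{F}$ is the family of winning sets (subsets of $X$) and $q$ is a positive integer, is the following two--player perfect information game. At the beginning of each round, Waiter offers Client $t$ free (that is, previously unclaimed) elements of $X$, where Waiter chooses both the elements and the number $t$ with $1\leqslant t\leqslant q+1$. Client claims one of these, and the remaining offered elements (if any) are claimed by Waiter. The game ends when all elements of $X$ are claimed. Client wins if he has fully claimed some winning set in $\mathcal{F}$; otherwise Waiter wins. The $k$--SAT game has board $X=\mathcal{C}^{(k)}_n$,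 and its winning sets are the sets $\mathcal{S}\subseteq\mathcal{C}^{(k)}_n$ whose conjunction $\bigwedge\mathcal{S}$ is not satisfiable. -}

module Defs where

open import Data.Bool using (Bool)
open import Data.Fin using (Fin)
open import Data.List using (List; []; _∷_; _++_; length)
open import Data.List.Membership.Propositional using (_∈_; _∉_)
open import Data.List.Relation.Unary.All using (All)
open import Data.List.Relation.Unary.Unique.Propositional using (Unique)
open import Data.Maybe using (Maybe; just; nothing)
open import Data.Nat using (ℕ; zero; suc; _+_; _≤_)
open import Data.Product using (∃-syntax; _×_; _,_)
open import Data.Vec using (Vec; []; _∷_; lookup)
open import Relation.Binary.PropositionalEquality using (_≡_)
open import Relation.Nullary using (¬_)

-- (i , true) is the literal xᵢ and (i , false) is its negation.
Literal : ℕ → Set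
Literal n = Fin n × Bool

width : ∀ {n} → Vec (Maybe Bool) n → ℕ
width []             = zero
width (nothing ∷ ls) = width ls
width (just _  ∷ ls) = suc (width ls)

-- A set of pairwise non-complementary literals is the same thing as a partial
-- map from variables to signs, so propositional equality of clauses is
-- equality of their sets of literals.
record Clause (k n : ℕ) : Set where
  constructor mkClause
  field
    signs   : Vec (Maybe Bool) n
    width≡k : width signs ≡ k

_∈ᶜ_ : ∀ {k n} → Literal n → Clause k n → Set
(i , b) ∈ᶜ c = lookup (Clause.signs c) i ≡ just b

Assignment : ℕ → Set
Assignment n = Vec Bool n

_⊨ˡ_ : ∀ {n} → Assignment n → Literal n → Set
a ⊨ˡ (i , b) = lookup a i ≡ b

_⊨_ : ∀ {k n} → Assignment n → Clause k n → Set
a ⊨ c = ∃[ l ] (l ∈ᶜ c × a ⊨ˡ l)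

Satisfiable : ∀ {k n} → List (Clause k n) → Set
Satisfiable {n = n} cs = ∃[ a ] All (a ⊨_) cs

-- The (1:q) Client–Waiter game whose board consists of all elements of X,
-- which is meant to be a finite type.
module ClientWaiter (X : Set) (q : ℕ) where

  record Offer (taken : List X) : Set where
    field
      elements : List X
      distinct : Unique elements
      nonempty : 1 ≤ length elements
      bounded  : length elements ≤ q + 1
      free     : All (_∉ taken) elements

  open Offer public

  Choice : ∀ {taken} → Offer taken → Set
  Choice o = ∃[ x ] x ∈ elements o

  -- Every offered element is claimed, by Client if he chose it and by Waiter
  -- otherwise, so `claimed` collects what both players own.
  mutual
    data History : Set where
      start : History
      round : (h : History) (o : Offer (claimed h)) → Choice o → History

    claimed : History → List X
    claimed start         = []
    claimed (round h o _) = elements o ++ claimed h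

  clientClaims : History → List X
  clientClaims start               = []
  clientClaims (round h _ (x , _)) = x ∷ clientClaims h

  Ended : History → Set
  Ended h = ∀ x → x ∈ claimed h

  ClientStrategy : Set
  ClientStrategy = (h : History) (o : Offer (claimed h)) → Choice o

  WaiterStrategy : Set
  WaiterStrategy = (h : History) → ¬ Ended h → Offer (claimed h)

  data FollowsClient (σ : ClientStrategy) : History → Set where
    start : FollowsClient σ start
    round : ∀ {h} → FollowsClient σ h → (o : Offer (claimed h)) →
            FollowsClient σ (round h o (σ h o))

  data FollowsWaiter (τ : WaiterStrategy) : History → Set where
    start : FollowsWaiter τ start
    round : ∀ {h} → FollowsWaiter τ h → (¬end : ¬ Ended h) (c : Choice (τ h ¬end)) →
            FollowsWaiter τ (round h (τ h ¬end) c)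

  ClientEnsuresAtEnd : (List X → Set) → Set
  ClientEnsuresAtEnd P =
    ∃[ σ ] (∀ h → FollowsClient σ h → Ended h → P (clientClaims h))

  WaiterEnsuresThroughout : (List X → Set) → Set
  WaiterEnsuresThroughout P =
    ∃[ τ ] (∀ h → FollowsWaiter τ h → P (clientClaims h))

{-# OPTIONS --safe #-}
-- (i) Client picks, among the offered clauses, one minimising the sum of
-- q ^ s · (q + 1) ^ u over the assignments that satisfy all his clauses, where s
-- and u count the claimed clauses that the assignment satisfies and falsifies.
-- By averaging over the offer, this sum grows by a factor of at most q per
-- claimed clause, so it is at most 2 ^ n · q ^ (s + u).  At the end
-- u ≥ n C k > q n, and 2 ^ n · q ^ u < (q + 1) ^ u leaves no satisfying
-- assignment.
--
-- (ii) Waiter fixes the variables one at a time, undecided ones counting as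
-- true.  For an undecided v he offers in one round all free clauses that
-- contain v and whose other literals are currently false; there are at most
-- 2 ((n - 1) C (k - 1)) ≤ q of them.  Client gets one of these, and v is decided
-- so as to satisfy it.  Every clause that touches a decided variable and is false is
-- then already claimed, and Client's clauses are all satisfied by decided
-- variables.
module Submission where

open import Defs
import Algebra.Properties.CommutativeSemigroup as CommutativeSemigroup
open import Data.Bool using (Bool; true; false; not; if_then_else_)
open import Data.Bool.Properties using (¬-not; not-¬) renaming (_≟_ to _≟ᵇ_)
open import Data.Fin using (Fin; punchIn) renaming (zero to fzero; suc to fsuc)
open import Data.Fin.Properties using (any?; punchInᵢ≢i)
open import Data.List using (List; []; _∷_; _++_; length; map; filter; deduplicate; concatMap)
open import Data.List.Properties
  using (length-++; length-map; length-filter; length-deduplicate; filter-++)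
open import Data.List.Membership.Propositional using (_∈_; _∉_; find; lose)
open import Data.List.Membership.Propositional.Properties
open import Data.List.Membership.DecPropositional using () renaming (_∈?_ to member?)
open import Data.List.Relation.Unary.All as All using (All; []; _∷_; all?)
open import Data.List.Relation.Unary.AllPairs using ([]; _∷_)
open import Data.List.Relation.Unary.Any as Any using (here; there)
open import Data.List.Relation.Unary.Unique.Propositional using (Unique)
import Data.List.Relation.Unary.Unique.Propositional.Properties as Unique
import Data.List.Relation.Unary.Unique.DecPropositional.Properties as DecUnique
open import Data.Maybe using (Maybe; just; nothing; fromMaybe)
open import Data.Maybe.Properties using (just-injective) renaming (≡-dec to ≡-decᵐ)
open import Data.Nat
  using (ℕ; zero; suc; _+_; _*_; _^_; _≤_; _<_; z≤n; s≤s; NonZero; _≤?_; >-nonZero)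
open import Data.Nat.Combinatorics
  using (_C_; nCn≡1; nC1≡n; nCk≡nC[n∸k]; nCk+nC[k+1]≡[n+1]C[k+1]; k>n⇒nCk≡0)
open import Data.Nat.ListAction using (sum)
open import Data.Nat.Properties
open import Data.Nat.Tactic.RingSolver using (solve-∀)
open import Data.Product using (∃-syntax; _×_; _,_; proj₁; proj₂)
open import Data.Sum using (_⊎_; inj₁; inj₂)
open import Data.Vec as Vec using (Vec; []; _∷_; lookup; insertAt; removeAt; _[_]≔_)
open import Data.Vec.Properties
  using (insertAt-lookup; insertAt-punchIn; insertAt-removeAt; lookup-map;
         lookup∘updateAt; lookup∘updateAt′; lookup-replicate; ∷-injectiveʳ)
  renaming (≡-dec to ≡-decᵛ)
open import Function using (_∘_)
open import Relation.Binary.Definitions using (DecidableEquality)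
open import Relation.Binary.PropositionalEquality
  using (_≡_; _≢_; refl; sym; trans; cong; cong₂; subst)
open import Relation.Nullary using (¬_; Dec; yes; no; does; ¬?; contradiction; _×-dec_)
open import Relation.Nullary.Decidable using (map′; decidable-stable)

open CommutativeSemigroup *-commutativeSemigroup using (x∙yz≈y∙xz)
  renaming (interchange to *-interchange)
open CommutativeSemigroup +-commutativeSemigroup using ()
  renaming (interchange to +-interchange)

private variable
  A B X : Set
  k n : ℕ

-- Counting and averaging over lists.

unique-⊆⇒length≤ : {xs ys : List A} → Unique xs → (∀ {x} → x ∈ xs → x ∈ ys) → length xs ≤ length ys
unique-⊆⇒length≤ [] _ = z≤n
unique-⊆⇒length≤ {xs = x ∷ xs} (x∉xs ∷ unique) xs⊆ys with ∈-∃++ (xs⊆ys (here refl))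
... | ls , rs , refl = begin
  suc (length xs)               ≤⟨ s≤s (unique-⊆⇒length≤ unique xs⊆rest) ⟩
  suc (length (ls ++ rs))       ≡⟨ cong suc (length-++ ls) ⟩
  suc (length ls + length rs)   ≡⟨ +-suc (length ls) (length rs) ⟨
  length ls + suc (length rs)   ≡⟨ length-++ ls ⟨
  length (ls ++ x ∷ rs)         ∎
  where
  open ≤-Reasoning
  xs⊆rest : ∀ {y} → y ∈ xs → y ∈ ls ++ rs
  xs⊆rest {y} y∈xs with ∈-++⁻ ls (xs⊆ys (there y∈xs))
  ... | inj₁ y∈ls         = ∈-++⁺ˡ y∈ls
  ... | inj₂ (here refl)  = contradiction refl (All.lookup x∉xs y∈xs)
  ... | inj₂ (there y∈rs) = ∈-++⁺ʳ ls y∈rs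

length-map-++-map : (f : A → X) (g : B → X) (xs : List A) (ys : List B) →
                    length (map f xs ++ map g ys) ≡ length xs + length ys
length-map-++-map f g xs ys =
  trans (length-++ (map f xs)) (cong₂ _+_ (length-map f xs) (length-map g ys))

sum-map-+ : (f g : A → ℕ) (xs : List A) →
            sum (map (λ x → f x + g x) xs) ≡ sum (map f xs) + sum (map g xs)
sum-map-+ f g []       = refl
sum-map-+ f g (x ∷ xs) rewrite sum-map-+ f g xs = +-interchange (f x) (g x) _ _

∈⇒≤-sum : (f : A → ℕ) {x : A} {xs : List A} → x ∈ xs → f x ≤ sum (map f xs)
∈⇒≤-sum f (here refl) = m≤m+n _ _
∈⇒≤-sum f (there x∈xs) = ≤-trans (∈⇒≤-sum f x∈xs) (m≤n+m _ _)

-- The witness found is a minimiser of `f`, but only the averaging consequence, cleared of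
-- denominators, is recorded; this is what the potential argument uses.
below-average : (f : A → ℕ) (xs : List A) → 1 ≤ length xs →
                ∃[ x ] (x ∈ xs × length xs * f x ≤ sum (map f xs))
below-average f (x ∷ [])     _ = x , here refl , ≤-refl
below-average f (x ∷ y ∷ ys) _ with below-average f (y ∷ ys) (s≤s z≤n)
... | z , z∈ , l*fz≤sum with f x ≤? f z
...   | yes fx≤fz = x , here refl ,
        +-monoʳ-≤ (f x) (≤-trans (*-monoʳ-≤ (length (y ∷ ys)) fx≤fz) l*fz≤sum)
...   | no  fx≰fz = z , there z∈ , +-mono-≤ (<⇒≤ (≰⇒> fx≰fz)) l*fz≤sum

-- Exponential inequalities.

-- The averaging step of the potential argument, cleared of denominators: an
-- assignment satisfying s of s + m offered clauses survives a uniformly random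
-- choice with probability s / (s + m) ≤ (q / (q + 1)) ^ m.
survival-bound : ∀ q s m → s + m ≤ suc q → s * suc q ^ m ≤ (s + m) * q ^ m
survival-bound q s zero    _ = ≤-reflexive (cong (_* 1) (sym (+-identityʳ s)))
survival-bound q s (suc m) s+1+m≤1+q = begin
  s * (suc q * suc q ^ m)       ≡⟨ x∙yz≈y∙xz s (suc q) (suc q ^ m) ⟩
  suc q * (s * suc q ^ m)       ≤⟨ *-monoʳ-≤ (suc q) (survival-bound q s m (m≤n⇒m≤1+n s+m≤q)) ⟩
  suc q * ((s + m) * q ^ m)     ≡⟨ expand q (s + m) (q ^ m) ⟩
  -- The size of the offer enters here: `s + m ≤ q` amounts to (s + m) / (s + m + 1) ≤ q / (q + 1),
  -- the price of one more falsified clause.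
  (s + m + q * (s + m)) * q ^ m ≤⟨ *-monoˡ-≤ (q ^ m) (+-monoˡ-≤ (q * (s + m)) s+m≤q) ⟩
  (q + q * (s + m)) * q ^ m     ≡⟨ collect q (s + m) (q ^ m) ⟩
  suc (s + m) * (q * q ^ m)     ≡⟨ cong (_* (q * q ^ m)) (+-suc s m) ⟨
  (s + suc m) * (q * q ^ m)     ∎
  where
  open ≤-Reasoning
  s+m≤q : s + m ≤ q
  s+m≤q = ≤-pred (subst (_≤ suc q) (+-suc s m) s+1+m≤1+q)
  expand : ∀ a b c → suc a * (b * c) ≡ (b + a * b) * c
  expand = solve-∀
  collect : ∀ a b c → (a + a * b) * c ≡ suc b * (a * c)
  collect = solve-∀

-- For positive q this is 1 + m / q ≤ (1 + 1 / q) ^ m multiplied by q ^ (m + 1), which keeps the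
-- induction in ℕ.
bernoulli : ∀ q m → q ^ m * (q + m) ≤ q * suc q ^ m
bernoulli q zero    = ≤-reflexive (base q)
  where
  base : ∀ a → 1 * (a + 0) ≡ a * 1
  base = solve-∀
bernoulli q (suc m) = begin
  q * q ^ m * (q + suc m)             ≤⟨ m≤m+n _ (q ^ m * m) ⟩
  q * q ^ m * (q + suc m) + q ^ m * m ≡⟨ collect q (q ^ m) m ⟩
  suc q * (q ^ m * (q + m))           ≤⟨ *-monoʳ-≤ (suc q) (bernoulli q m) ⟩
  suc q * (q * suc q ^ m)             ≡⟨ x∙yz≈y∙xz (suc q) q (suc q ^ m) ⟩
  q * (suc q * suc q ^ m)             ∎
  where
  open ≤-Reasoning
  collect : ∀ a p b → a * p * (a + suc b) + p * b ≡ suc a * (p * (a + b))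
  collect = solve-∀

-- `bernoulli` at m = q, that is (1 + 1 / q) ^ q ≥ 2: every q falsified clauses pay for the two
-- values of one variable.
2*q^q≤[1+q]^q : ∀ q .{{_ : NonZero q}} → 2 * q ^ q ≤ suc q ^ q
2*q^q≤[1+q]^q q = *-cancelˡ-≤ q (≤-trans (≤-reflexive (shape q (q ^ q))) (bernoulli q q))
  where
  shape : ∀ a p → a * (2 * p) ≡ p * (a + a)
  shape = solve-∀

^-distribʳ : ∀ a b m → (a * b) ^ m ≡ a ^ m * b ^ m
^-distribʳ a b zero    = refl
^-distribʳ a b (suc m) rewrite ^-distribʳ a b m = *-interchange a b (a ^ m) (b ^ m)

-- The ratio (1 + 1 / q) ^ m does not decrease in m. This serves twice: to pass from q n + 1 to any
-- larger N, and from N to the number of falsified elements claimed by the end of play.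
extend-^-bound : ∀ L {q m r} .{{_ : NonZero q}} → m ≤ r →
                 L * q ^ m < suc q ^ m → L * q ^ r < suc q ^ r
extend-^-bound L {q} {m} m≤r bound with m≤n⇒∃[o]m+o≡n m≤r
... | o , refl = begin-strict
  L * q ^ (m + o)       ≡⟨ cong (L *_) (^-distribˡ-+-* q m o) ⟩
  L * (q ^ m * q ^ o)   ≡⟨ *-assoc L (q ^ m) (q ^ o) ⟨
  L * q ^ m * q ^ o     <⟨ *-monoˡ-< (q ^ o) {{m^n≢0 q o}} bound ⟩
  suc q ^ m * q ^ o     ≤⟨ *-monoʳ-≤ (suc q ^ m) (^-monoˡ-≤ o (n≤1+n q)) ⟩
  suc q ^ m * suc q ^ o ≡⟨ ^-distribˡ-+-* (suc q) m o ⟨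
  suc q ^ (m + o)       ∎
  where open ≤-Reasoning

2^n*q^N<[1+q]^N : ∀ n {q N} .{{_ : NonZero q}} → q * n < N → 2 ^ n * q ^ N < suc q ^ N
2^n*q^N<[1+q]^N n {q} qn<N = extend-^-bound (2 ^ n) qn<N (begin-strict
  2 ^ n * q ^ suc (q * n)     ≡⟨ x∙yz≈y∙xz (2 ^ n) q (q ^ (q * n)) ⟩
  q * (2 ^ n * q ^ (q * n))   ≡⟨ cong (λ p → q * (2 ^ n * p)) (^-*-assoc q q n) ⟨
  q * (2 ^ n * (q ^ q) ^ n)   ≡⟨ cong (q *_) (^-distribʳ 2 (q ^ q) n) ⟨
  q * (2 * q ^ q) ^ n         ≤⟨ *-monoʳ-≤ q (^-monoˡ-≤ n (2*q^q≤[1+q]^q q)) ⟩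
  q * (suc q ^ q) ^ n         ≡⟨ cong (q *_) (^-*-assoc (suc q) q n) ⟩
  -- The n blocks of q factors have absorbed 2 ^ n; the one exponent beyond q n makes the inequality
  -- strict.
  q * suc q ^ (q * n)         <⟨ *-monoˡ-< (suc q ^ (q * n)) {{m^n≢0 (suc q) (q * n)}} (n<1+n q) ⟩
  suc q ^ suc (q * n)         ∎)
  where
  open ≤-Reasoning

-- Client's potential strategy on an abstract board.

module Potential {A X : Set} {_⊩_ : A → X → Set} (_⊩?_ : ∀ a x → Dec (a ⊩ x))
                 (q : ℕ) .{{_ : NonZero q}} where

  open ClientWaiter X q

  sat unsat : A → List X → ℕ
  sat   a xs = length (filter (a ⊩?_) xs)
  unsat a xs = length (filter (λ x → ¬? (a ⊩? x)) xs)

  sat+unsat≡length : ∀ a xs → sat a xs + unsat a xs ≡ length xs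
  sat+unsat≡length a []       = refl
  sat+unsat≡length a (x ∷ xs) with a ⊩? x
  ... | yes _ = cong suc (sat+unsat≡length a xs)
  ... | no  _ = trans (+-suc _ _) (cong suc (sat+unsat≡length a xs))

  -- Up to the factor q ^ length xs, common to all `a`, this is the Erdős-Selfridge type weight (1 +
  -- 1 / q) ^ unsat a xs, scaled to stay in ℕ.
  weight : A → List X → ℕ
  weight a xs = q ^ sat a xs * suc q ^ unsat a xs

  weight-++ : ∀ a xs ys → weight a (xs ++ ys) ≡ weight a xs * weight a ys
  weight-++ a xs ys
    rewrite filter-++ (a ⊩?_) xs ys | filter-++ (λ x → ¬? (a ⊩? x)) xs ys
          | length-++ (filter (a ⊩?_) xs) {filter (a ⊩?_) ys}
          | length-++ (filter (λ x → ¬? (a ⊩? x)) xs) {filter (λ x → ¬? (a ⊩? x)) ys}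
          | ^-distribˡ-+-* q (sat a xs) (sat a ys)
          | ^-distribˡ-+-* (suc q) (unsat a xs) (unsat a ys)
          = *-interchange (q ^ sat a xs) (q ^ sat a ys) (suc q ^ unsat a xs) (suc q ^ unsat a ys)

  -- Branching on `does` lets `threat a (x ∷ cs) taken` reduce as soon as `a ⊩? x` is known.
  threat : A → List X → List X → ℕ
  threat a cs taken = if does (all? (a ⊩?_) cs) then weight a taken else 0

  potential : List A → List X → List X → ℕ
  potential as cs taken = sum (map (λ a → threat a cs taken) as)

  potential-[] : ∀ as → potential as [] [] ≡ length as
  potential-[] []       = refl
  potential-[] (_ ∷ as) = cong suc (potential-[] as)

  -- Only the offered elements that `a` satisfies keep it alive, and each of them leaves it with the
  -- same threat.
  sum-threat : ∀ a cs taken xs →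
    sum (map (λ x → threat a (x ∷ cs) taken) xs) ≡ sat a xs * threat a cs taken
  sum-threat a cs taken []       = refl
  sum-threat a cs taken (x ∷ xs) with a ⊩? x
  ... | yes _ = cong (threat a cs taken +_) (sum-threat a cs taken xs)
  ... | no  _ = sum-threat a cs taken xs

  threat-++ : ∀ a cs xs taken → threat a cs (xs ++ taken) ≡ weight a xs * threat a cs taken
  threat-++ a cs xs taken with does (all? (a ⊩?_) cs)
  ... | true  = weight-++ a xs taken
  ... | false = sym (*-zeroʳ (weight a xs))

  -- The chance s / (s + u) of surviving a random choice offsets the growth of the weight: by
  -- `survival-bound` it brings the factor (q + 1) ^ u down to q ^ u.
  sat*weight≤ : ∀ a xs → length xs ≤ suc q → sat a xs * weight a xs ≤ length xs * q ^ length xs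
  sat*weight≤ a xs |xs|≤1+q = begin
    s * (q ^ s * suc q ^ u)   ≡⟨ x∙yz≈y∙xz s (q ^ s) (suc q ^ u) ⟩
    q ^ s * (s * suc q ^ u)   ≤⟨ *-monoʳ-≤ (q ^ s) (survival-bound q s u s+u≤1+q) ⟩
    q ^ s * ((s + u) * q ^ u) ≡⟨ x∙yz≈y∙xz (q ^ s) (s + u) (q ^ u) ⟩
    (s + u) * (q ^ s * q ^ u) ≡⟨ cong ((s + u) *_) (^-distribˡ-+-* q s u) ⟨
    (s + u) * q ^ (s + u)     ≡⟨ cong (λ l → l * q ^ l) (sat+unsat≡length a xs) ⟩
    length xs * q ^ length xs ∎
    where
    open ≤-Reasoning
    s u : ℕ
    s = sat a xs
    u = unsat a xs
    s+u≤1+q : s + u ≤ suc q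
    s+u≤1+q = subst (_≤ suc q) (sym (sat+unsat≡length a xs)) |xs|≤1+q

  -- Averaged over Client's choice, one round multiplies the potential by at most q per claimed
  -- element. Both sides are additive in `as`, so it suffices to bound each assignment separately.
  sum-potential≤ : ∀ as cs xs taken → length xs ≤ suc q →
    sum (map (λ x → potential as (x ∷ cs) (xs ++ taken)) xs)
      ≤ length xs * q ^ length xs * potential as cs taken
  sum-potential≤ []       cs xs taken _ = ≤-trans (≤-reflexive (zeros xs)) z≤n
    where
    zeros : (xs : List X) → sum (map (λ _ → 0) xs) ≡ 0
    zeros []       = refl
    zeros (_ ∷ xs) = zeros xs
  sum-potential≤ (a ∷ as) cs xs taken |xs|≤1+q = begin
    sum (map (λ x → threat a (x ∷ cs) (xs ++ taken) + potential as (x ∷ cs) (xs ++ taken)) xs)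
      ≡⟨ sum-map-+ _ _ xs ⟩
    sum (map (λ x → threat a (x ∷ cs) (xs ++ taken)) xs)
      + sum (map (λ x → potential as (x ∷ cs) (xs ++ taken)) xs)
      ≤⟨ +-mono-≤ threat-bound (sum-potential≤ as cs xs taken |xs|≤1+q) ⟩
    K * threat a cs taken + K * potential as cs taken
      ≡⟨ *-distribˡ-+ K (threat a cs taken) (potential as cs taken) ⟨
    K * (threat a cs taken + potential as cs taken) ∎
    where
    open ≤-Reasoning
    K : ℕ
    K = length xs * q ^ length xs
    threat-bound : sum (map (λ x → threat a (x ∷ cs) (xs ++ taken)) xs) ≤ K * threat a cs taken
    threat-bound = begin
      sum (map (λ x → threat a (x ∷ cs) (xs ++ taken)) xs) ≡⟨ sum-threat a cs (xs ++ taken) xs ⟩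
      sat a xs * threat a cs (xs ++ taken)             ≡⟨ cong (sat a xs *_) (threat-++ a cs xs taken) ⟩
      sat a xs * (weight a xs * threat a cs taken)     ≡⟨ *-assoc (sat a xs) _ _ ⟨
      sat a xs * weight a xs * threat a cs taken       ≤⟨ *-monoˡ-≤ _ (sat*weight≤ a xs |xs|≤1+q) ⟩
      K * threat a cs taken                            ∎

  best : (as : List A) (h : History) (o : Offer (claimed h)) →
    ∃[ x ] (x ∈ elements o ×
            length (elements o) * potential as (x ∷ clientClaims h) (elements o ++ claimed h)
              ≤ sum (map (λ x → potential as (x ∷ clientClaims h) (elements o ++ claimed h))
                         (elements o)))
  best as h o = below-average _ (elements o) (nonempty o)

  minimise : List A → ClientStrategy
  minimise as h o = proj₁ (best as h o) , proj₁ (proj₂ (best as h o))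

  -- A choice no worse than average inherits the bound of `sum-potential≤`, so an offer of t
  -- elements costs a factor q ^ t; at the start every weight is 1.
  potential≤ : ∀ as {h} → FollowsClient (minimise as) h →
    potential as (clientClaims h) (claimed h) ≤ q ^ length (claimed h) * length as
  potential≤ as start = ≤-reflexive (trans (potential-[] as) (sym (*-identityˡ _)))
  potential≤ as (round {h} follows o) = *-cancelˡ-≤ t {{>-nonZero (nonempty o)}} (begin
    t * potential as (x ∷ cs) (E ++ T)                   ≤⟨ proj₂ (proj₂ (best as h o)) ⟩
    sum (map (λ x → potential as (x ∷ cs) (E ++ T)) E)   ≤⟨ sum-potential≤ as cs E T t≤1+q ⟩
    t * q ^ t * potential as cs T                        ≤⟨ *-monoʳ-≤ (t * q ^ t) (potential≤ as follows) ⟩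
    t * q ^ t * (q ^ length T * length as)               ≡⟨ shape t (q ^ t) (q ^ length T) (length as) ⟩
    t * (q ^ t * q ^ length T * length as)               ≡⟨ cong (λ p → t * (p * length as)) (^-distribˡ-+-* q t (length T)) ⟨
    t * (q ^ (t + length T) * length as)                 ≡⟨ cong (λ l → t * (q ^ l * length as)) (length-++ E) ⟨
    t * (q ^ length (E ++ T) * length as)                ∎)
    where
    open ≤-Reasoning
    E T cs : List X
    E  = elements o
    T  = claimed h
    cs = clientClaims h
    x : X
    x = proj₁ (best as h o)
    t : ℕ
    t = length E
    t≤1+q : t ≤ suc q
    t≤1+q = subst (t ≤_) (+-comm q 1) (bounded o)
    shape : ∀ a b c d → a * b * (c * d) ≡ a * (b * c * d)
    shape = solve-∀

  threat-alive : ∀ a cs taken → All (a ⊩_) cs → threat a cs taken ≡ weight a taken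
  threat-alive a cs taken alive with all? (a ⊩?_) cs
  ... | yes _    = refl
  ... | no ¬alive = contradiction alive ¬alive

  -- An `a` alive at the end contributes its whole weight q ^ s (q + 1) ^ u to a potential of at
  -- most q ^ (s + u) times `length as`. Cancelling q ^ s contradicts the bound, which extends from
  -- N to u.
  client-hits-all : ∀ as N → length as * q ^ N < suc q ^ N →
    (F : A → List X) → (∀ a → Unique (F a)) → (∀ a → N ≤ length (F a)) →
    (∀ a {x} → x ∈ F a → ¬ (a ⊩ x)) →
    ClientEnsuresAtEnd (λ cs → ∀ {a} → a ∈ as → ¬ All (a ⊩_) cs)
  client-hits-all as N bound F unique large falsified = minimise as , wins
    where
    open ≤-Reasoning
    wins : ∀ h → FollowsClient (minimise as) h → Ended h →
           ∀ {a} → a ∈ as → ¬ All (a ⊩_) (clientClaims h)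
    wins h follows ended {a} a∈as alive =
      <⇒≱ (extend-^-bound (length as) N≤u bound) (*-cancelˡ-≤ (q ^ s) {{m^n≢0 q s}} (begin
        q ^ s * suc q ^ u                         ≡⟨ threat-alive a (clientClaims h) T alive ⟨
        threat a (clientClaims h) T               ≤⟨ ∈⇒≤-sum (λ a → threat a (clientClaims h) T) a∈as ⟩
        potential as (clientClaims h) T           ≤⟨ potential≤ as follows ⟩
        q ^ length T * length as                  ≡⟨ cong (λ l → q ^ l * length as) (sat+unsat≡length a T) ⟨
        q ^ (s + u) * length as                   ≡⟨ cong (_* length as) (^-distribˡ-+-* q s u) ⟩
        q ^ s * q ^ u * length as                 ≡⟨ shape (q ^ s) (q ^ u) (length as) ⟩
        q ^ s * (length as * q ^ u)               ∎))
      where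
      T : List X
      T = claimed h
      s u : ℕ
      s = sat a T
      u = unsat a T
      N≤u : N ≤ u
      -- All of `F a` has been claimed and `a` satisfies none of it; distinctness turns this
      -- inclusion into a count.
      N≤u = ≤-trans (large a) (unique-⊆⇒length≤ (unique a)
        (λ {x} x∈F → ∈-filter⁺ (λ x → ¬? (a ⊩? x)) (ended x) (falsified a x∈F)))
      shape : ∀ a b c → a * b * c ≡ a * (c * b)
      shape = solve-∀

-- Assignments and the clauses they falsify.

clause-≡ : {c d : Clause k n} → Clause.signs c ≡ Clause.signs d → c ≡ d
clause-≡ {c = mkClause _ w} {mkClause _ w′} refl = cong (mkClause _) (≡-irrelevant w w′)

_≟ᶜ_ : DecidableEquality (Clause k n)
c ≟ᶜ d = map′ clause-≡ (cong Clause.signs) (≡-decᵛ (≡-decᵐ _≟ᵇ_) (Clause.signs c) (Clause.signs d))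

_∈?_ : (c : Clause k n) (cs : List (Clause k n)) → Dec (c ∈ cs)
_∈?_ = member? _≟ᶜ_

_⊨?_ : (a : Assignment n) (c : Clause k n) → Dec (a ⊨ c)
a ⊨? c = map′ (λ (i , p) → (i , lookup a i) , p , refl) (λ { ((i , _) , p , refl) → i , p })
              (any? λ i → ≡-decᵐ _≟ᵇ_ (lookup (Clause.signs c) i) (just (lookup a i)))

⊭⇒signs≢ : (a : Assignment n) (c : Clause k n) → ¬ a ⊨ c →
           ∀ i → lookup (Clause.signs c) i ≢ just (lookup a i)
⊭⇒signs≢ a c a⊭c i eq = a⊭c ((i , lookup a i) , eq , refl)

assignments : ∀ n → List (Assignment n)
assignments zero    = [] ∷ []
assignments (suc n) = map (true ∷_) (assignments n) ++ map (false ∷_) (assignments n)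

length-assignments : ∀ n → length (assignments n) ≡ 2 ^ n
length-assignments zero    = refl
length-assignments (suc n) = begin-equality
  length (assignments (suc n))                    ≡⟨ length-map-++-map _ _ (assignments n) (assignments n) ⟩
  length (assignments n) + length (assignments n) ≡⟨ cong₂ _+_ (length-assignments n) (length-assignments n) ⟩
  2 ^ n + 2 ^ n                                   ≡⟨ cong (2 ^ n +_) (+-identityʳ (2 ^ n)) ⟨
  2 ^ suc n                                       ∎
  where open ≤-Reasoning

∈-assignments : (a : Assignment n) → a ∈ assignments n
∈-assignments []          = here refl
∈-assignments (true  ∷ a) = ∈-++⁺ˡ (∈-map⁺ _ (∈-assignments a))
∈-assignments (false ∷ a) = ∈-++⁺ʳ (map (true ∷_) (assignments _)) (∈-map⁺ _ (∈-assignments a))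

skip : Clause k n → Clause k (suc n)
skip (mkClause s w) = mkClause (nothing ∷ s) w

extend : Bool → Clause k n → Clause (suc k) (suc n)
extend b (mkClause s w) = mkClause (just b ∷ s) (cong suc w)

falsified : Assignment n → ∀ k → List (Clause k n)
falsified []      zero    = mkClause [] refl ∷ []
falsified []      (suc k) = []
falsified (_ ∷ a) zero    = map skip (falsified a zero)
falsified (b ∷ a) (suc k) = map (extend (not b)) (falsified a k) ++ map skip (falsified a (suc k))

nC0≡1 : ∀ n → n C 0 ≡ 1
nC0≡1 n = trans (nCk≡nC[n∸k] {n = n} z≤n) (nCn≡1 n)

-- The variables of a falsified clause determine its signs, so these clauses correspond to the
-- k-subsets of the variables; clauses with and without the first variable give the two terms of
-- Pascal's rule.
length-falsified : (a : Assignment n) (k : ℕ) → length (falsified a k) ≡ n C k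
length-falsified []      zero    = refl
length-falsified []      (suc k) = refl
length-falsified {suc n} (_ ∷ a) zero = begin-equality
  length (map skip (falsified a zero)) ≡⟨ length-map skip (falsified a zero) ⟩
  length (falsified a zero)            ≡⟨ length-falsified a zero ⟩
  n C 0                                ≡⟨ nC0≡1 n ⟩
  1                                    ≡⟨ nC0≡1 (suc n) ⟨
  suc n C 0                            ∎
  where open ≤-Reasoning
length-falsified {suc n} (b ∷ a) (suc k) = begin-equality
  length (map (extend (not b)) (falsified a k) ++ map skip (falsified a (suc k)))
    ≡⟨ length-map-++-map _ _ (falsified a k) (falsified a (suc k)) ⟩
  length (falsified a k) + length (falsified a (suc k))
    ≡⟨ cong₂ _+_ (length-falsified a k) (length-falsified a (suc k)) ⟩
  n C k + n C suc k
    ≡⟨ nCk+nC[k+1]≡[n+1]C[k+1] n k ⟩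
  suc n C suc k ∎
  where open ≤-Reasoning

falsified-sound : (a : Assignment n) (k : ℕ) {c : Clause k n} → c ∈ falsified a k → ¬ a ⊨ c
falsified-sound []      zero    (here refl) ((() , _) , _)
falsified-sound (_ ∷ a) zero    c∈ sat with ∈-map⁻ skip c∈
... | d , d∈ , refl with sat
...   | (fsuc i , b) , p , r = falsified-sound a zero d∈ ((i , b) , p , r)
falsified-sound (b ∷ a) (suc k) c∈ sat with ∈-++⁻ (map (extend (not b)) (falsified a k)) c∈
... | inj₁ c∈ˡ with ∈-map⁻ (extend (not b)) c∈ˡ
...   | d , d∈ , refl with sat
...     | (fzero  , _) , p , refl = not-¬ refl (sym (just-injective p))
...     | (fsuc i , b′) , p , r   = falsified-sound a k d∈ ((i , b′) , p , r)
falsified-sound (b ∷ a) (suc k) c∈ sat | inj₂ c∈ʳ with ∈-map⁻ skip c∈ʳ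
... | d , d∈ , refl with sat
...   | (fsuc i , b′) , p , r = falsified-sound a (suc k) d∈ ((i , b′) , p , r)

-- The hypothesis speaks of signs position by position, so it restricts directly to fewer variables,
-- here along `fsuc` and in `pivotal-complete` along `punchIn`.
falsified-complete : (a : Assignment n) (c : Clause k n) →
  (∀ i → lookup (Clause.signs c) i ≢ just (lookup a i)) → c ∈ falsified a k
falsified-complete [] (mkClause [] refl) _ = here refl
falsified-complete {k = zero} (b ∷ a) (mkClause (nothing ∷ s) w) clash =
  ∈-map⁺ skip (falsified-complete a (mkClause s w) (clash ∘ fsuc))
falsified-complete {k = suc k} (b ∷ a) (mkClause (nothing ∷ s) w) clash =
  ∈-++⁺ʳ (map (extend (not b)) (falsified a k))
    (∈-map⁺ skip (falsified-complete a (mkClause s w) (clash ∘ fsuc)))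
falsified-complete (b ∷ a) (mkClause (just b′ ∷ s) refl) clash
  with refl ← ¬-not {b′} {b} (clash fzero ∘ cong just) =
  ∈-++⁺ˡ (∈-map⁺ (extend (not b)) (falsified-complete a (mkClause s refl) (clash ∘ fsuc)))

skip-injective : {c d : Clause k n} → skip c ≡ skip d → c ≡ d
skip-injective eq = clause-≡ (∷-injectiveʳ (cong Clause.signs eq))

extend-injective : ∀ {b} {c d : Clause k n} → extend b c ≡ extend b d → c ≡ d
extend-injective eq = clause-≡ (∷-injectiveʳ (cong Clause.signs eq))

falsified-unique : (a : Assignment n) (k : ℕ) → Unique (falsified a k)
falsified-unique []      zero    = [] ∷ []
falsified-unique []      (suc k) = []
falsified-unique (_ ∷ a) zero    = Unique.map⁺ skip-injective (falsified-unique a zero)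
falsified-unique (b ∷ a) (suc k) =
  Unique.++⁺ (Unique.map⁺ extend-injective (falsified-unique a k))
             (Unique.map⁺ skip-injective (falsified-unique a (suc k)))
             disjoint
  where
  disjoint : ∀ {c} → ¬ (c ∈ map (extend (not b)) (falsified a k) × c ∈ map skip (falsified a (suc k)))
  disjoint (c∈ˡ , c∈ʳ) with ∈-map⁻ (extend (not b)) c∈ˡ | ∈-map⁻ skip c∈ʳ
  ... | _ , _ , refl | _ , _ , ()

-- Each clause is falsified by an assignment opposing all its literals, so these lists cover the
-- board. Repetitions are harmless: the list is only searched for a free clause.
clauses : ∀ k n → List (Clause k n)
clauses k n = concatMap (λ a → falsified a k) (assignments n)

∈-clauses : (c : Clause k n) → c ∈ clauses k n
∈-clauses {k} c@(mkClause s _) = ∈-concatMap⁺ (λ a → falsified a k)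
  (lose (∈-assignments opposite) (falsified-complete opposite c λ i eq →
    differs (lookup s i) (trans eq (cong just (lookup-map i negate s)))))
  where
  negate : Maybe Bool → Bool
  negate (just b) = not b
  negate nothing  = true
  opposite : Assignment _
  opposite = Vec.map negate s
  differs : ∀ l → l ≢ just (negate l)
  differs (just b) eq = not-¬ refl (just-injective eq)

client-wins : ∀ k n q → 1 ≤ q → q * n < n C k →
  ClientWaiter.ClientEnsuresAtEnd (Clause k n) q (λ cs → ¬ Satisfiable cs)
client-wins k n q 1≤q qn<nCk
  with σ , wins ← Potential.client-hits-all _⊨?_ q {{>-nonZero 1≤q}} (assignments n) (n C k)
         (subst (λ l → l * q ^ (n C k) < suc q ^ (n C k)) (sym (length-assignments n))
           (2^n*q^N<[1+q]^N n {{>-nonZero 1≤q}} qn<nCk))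
         (λ a → falsified a k) (λ a → falsified-unique a k)
         (λ a → ≤-reflexive (sym (length-falsified a k)))
         (λ a → falsified-sound a k)
  = σ , λ h follows ended (a , alive) → wins h follows ended (∈-assignments a) alive

-- Clauses through a given variable, and partial assignments.

width-insertAt : (s : Vec (Maybe Bool) n) (v : Fin (suc n)) (b : Bool) →
                 width (insertAt s v (just b)) ≡ suc (width s)
width-insertAt s              fzero    b = refl
width-insertAt (nothing ∷ s)  (fsuc v) b = width-insertAt s v b
width-insertAt (just _  ∷ s)  (fsuc v) b = cong suc (width-insertAt s v b)

insertLiteral : Literal (suc n) → Clause k n → Clause (suc k) (suc n)
insertLiteral (v , b) (mkClause s w) =
  mkClause (insertAt s v (just b)) (trans (width-insertAt s v b) (cong suc w))

lookup-removeAt : (xs : Vec A (suc n)) (i : Fin (suc n)) (j : Fin n) →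
                  lookup (removeAt xs i) j ≡ lookup xs (punchIn i j)
lookup-removeAt xs i j = trans (sym (insertAt-punchIn (removeAt xs i) i (lookup xs i) j))
  (cong (λ ys → lookup ys (punchIn i j)) (insertAt-removeAt xs i))

-- The clauses through `v` whose truth is left to `v` alone. Both signs are inserted after `v` is
-- deleted, so the list does not depend on the value of `a` at `v`.
pivotal : Assignment (suc n) → Fin (suc n) → ∀ k → List (Clause (suc k) (suc n))
pivotal a v k = map (insertLiteral (v , true))  (falsified (removeAt a v) k)
             ++ map (insertLiteral (v , false)) (falsified (removeAt a v) k)

length-pivotal : (a : Assignment (suc n)) (v : Fin (suc n)) (k : ℕ) →
                 length (pivotal a v k) ≡ 2 * (n C k)
length-pivotal {n} a v k = begin-equality
  length (pivotal a v k)    ≡⟨ length-map-++-map _ _ F F ⟩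
  length F + length F       ≡⟨ cong (λ l → l + l) (length-falsified (removeAt a v) k) ⟩
  n C k + n C k             ≡⟨ cong (n C k +_) (+-identityʳ (n C k)) ⟨
  2 * (n C k)               ∎
  where
  open ≤-Reasoning
  F : List (Clause k n)
  F = falsified (removeAt a v) k

pivotal-sound : (a : Assignment (suc n)) (v : Fin (suc n)) {c : Clause (suc k) (suc n)} →
  c ∈ pivotal a v k → ∃[ b ] (v , b) ∈ᶜ c
pivotal-sound {k = k} a v c∈ with ∈-++⁻ (map (insertLiteral (v , true)) (falsified (removeAt a v) k)) c∈
... | inj₁ c∈ˡ with d , _ , refl ← ∈-map⁻ (insertLiteral (v , true))  c∈ˡ = true  , insertAt-lookup (Clause.signs d) v _
... | inj₂ c∈ʳ with d , _ , refl ← ∈-map⁻ (insertLiteral (v , false)) c∈ʳ = false , insertAt-lookup (Clause.signs d) v _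

pivotal-complete : (a : Assignment (suc n)) (v : Fin (suc n)) {b : Bool} (c : Clause (suc k) (suc n)) →
  (v , b) ∈ᶜ c → (∀ i → i ≢ v → lookup (Clause.signs c) i ≢ just (lookup a i)) → c ∈ pivotal a v k
pivotal-complete {k = k} a v {b} c@(mkClause s w) v∈c clash = at b signs≡
  where
  rest : Vec (Maybe Bool) _
  rest = removeAt s v
  signs≡ : insertAt rest v (just b) ≡ s
  signs≡ = trans (cong (insertAt rest v) (sym v∈c)) (insertAt-removeAt s v)
  d : Clause k _
  d = mkClause rest (suc-injective
        (trans (sym (width-insertAt rest v b)) (trans (cong width signs≡) w)))
  d∈ : d ∈ falsified (removeAt a v) k
  d∈ = falsified-complete (removeAt a v) d λ j eq →
    clash (punchIn v j) (punchInᵢ≢i v j)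
      (trans (sym (lookup-removeAt s v j)) (trans eq (cong just (lookup-removeAt a v j))))
  at : ∀ b → insertAt rest v (just b) ≡ s → c ∈ pivotal a v k
  at true  eq = ∈-++⁺ˡ (subst (_∈ _) (clause-≡ eq) (∈-map⁺ (insertLiteral (v , true)) d∈))
  at false eq = ∈-++⁺ʳ (map (insertLiteral (v , true)) (falsified (removeAt a v) k))
                  (subst (_∈ _) (clause-≡ eq) (∈-map⁺ (insertLiteral (v , false)) d∈))

occurs : (c : Clause (suc k) n) → ∃[ l ] l ∈ᶜ c
occurs (mkClause (nothing ∷ s) w) with (i , b) , p ← occurs (mkClause s w) = (fsuc i , b) , p
occurs (mkClause (just b ∷ s)  _) = (fzero , b) , refl

total : Vec (Maybe Bool) n → Assignment n
total = Vec.map (fromMaybe true)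

total-just : (ρ : Vec (Maybe Bool) n) {i : Fin n} {b : Bool} →
             lookup ρ i ≡ just b → lookup (total ρ) i ≡ b
total-just ρ {i} eq = trans (lookup-map i (fromMaybe true) ρ) (cong (fromMaybe true) eq)

nothing⊎just : (m : Maybe A) → m ≡ nothing ⊎ ∃[ x ] m ≡ just x
nothing⊎just nothing  = inj₁ refl
nothing⊎just (just x) = inj₂ (x , refl)

-- Waiter's strategy and its invariant.

module Waiter (k n q : ℕ) (room : 2 * (n C k) ≤ q + 1) where

  -- Width and number of variables are successors, so that deleting a variable leaves `k` and `n`;
  -- `room` lets a whole batch fit into one offer.
  Board : Set
  Board = Clause (suc k) (suc n)

  open ClientWaiter Board q


  Partial : Set
  Partial = Vec (Maybe Bool) (suc n)

  unclaimed : List Board → List Board → List Board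
  unclaimed taken = filter (λ c → ¬? (c ∈? taken))

  -- Deduplication supplies the distinctness an offer requires and can only shorten the list.
  batch : Partial → List Board → Fin (suc n) → List Board
  batch ρ taken v = deduplicate _≟ᶜ_ (unclaimed taken (pivotal (total ρ) v k))

  ∈-batch⁺ : ∀ ρ {taken v c} → c ∉ taken → c ∈ pivotal (total ρ) v k → c ∈ batch ρ taken v
  ∈-batch⁺ ρ c∉ c∈ = ∈-deduplicate⁺ _≟ᶜ_ (∈-filter⁺ (λ c → ¬? (c ∈? _)) c∈ c∉)

  ∈-batch⁻ : ∀ ρ {taken v c} → c ∈ batch ρ taken v → c ∈ pivotal (total ρ) v k × c ∉ taken
  ∈-batch⁻ ρ {taken} {v} c∈ = ∈-filter⁻ (λ c → ¬? (c ∈? taken))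
    (∈-deduplicate⁻ _≟ᶜ_ (unclaimed taken (pivotal (total ρ) v k)) c∈)

  length-batch≤ : ∀ ρ taken v → length (batch ρ taken v) ≤ q + 1
  length-batch≤ ρ taken v = begin
    length (batch ρ taken v)      ≤⟨ length-deduplicate _≟ᶜ_ (unclaimed taken P) ⟩
    length (unclaimed taken P)    ≤⟨ length-filter (λ c → ¬? (c ∈? taken)) P ⟩
    length P                      ≡⟨ length-pivotal (total ρ) v k ⟩
    2 * (n C k)                   ≤⟨ room ⟩
    q + 1                         ∎
    where
    open ≤-Reasoning
    P : List Board
    P = pivotal (total ρ) v k

  -- An undecided variable with an empty batch is passed over, since an offer needs an element; it
  -- may become a target later, once decisions have changed `total ρ`.
  Target : Partial → List Board → Fin (suc n) → Set
  Target ρ taken v = lookup ρ v ≡ nothing × 1 ≤ length (batch ρ taken v)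

  target? : ∀ ρ taken → Dec (∃[ v ] Target ρ taken v)
  target? ρ taken = any? λ v →
    ≡-decᵐ _≟ᵇ_ (lookup ρ v) nothing ×-dec (1 ≤? length (batch ρ taken v))

  freeClause : ∀ {taken} → ¬ (∀ c → c ∈ taken) → ∃[ c ] c ∉ taken
  freeClause {taken} ¬all with Any.any? (λ c → ¬? (c ∈? taken)) (clauses (suc k) (suc n))
  ... | yes free with c , _ , c∉ ← find free = c , c∉
  ... | no ¬free = contradiction
    (λ c → decidable-stable (c ∈? taken) (λ c∉ → ¬free (lose (∈-clauses c) c∉))) ¬all

  offer : ∀ ρ {taken} → Dec (∃[ v ] Target ρ taken v) → ¬ (∀ c → c ∈ taken) → Offer taken
  offer ρ {taken} (yes (v , _ , 1≤l)) _ = record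
    { elements = batch ρ taken v
    ; distinct = DecUnique.deduplicate-! _≟ᶜ_ (unclaimed taken (pivotal (total ρ) v k))
    ; nonempty = 1≤l
    ; bounded  = length-batch≤ ρ taken v
    ; free     = All.tabulate (λ c∈ → proj₂ (∈-batch⁻ ρ c∈))
    }
  -- Under the invariant `Safe`, the lack of a target means that every free clause is true under
  -- `total ρ`, so any one of them can be forced on Client.
  offer ρ (no _) ¬all = record
    { elements = proj₁ (freeClause ¬all) ∷ []
    ; distinct = [] ∷ []
    ; nonempty = s≤s z≤n
    ; bounded  = m≤n+m 1 q
    ; free     = proj₂ (freeClause ¬all) ∷ []
    }

  -- With no target left, all clauses violated by the default completion are
  -- claimed, so that completion can be adopted for good.
  update : ∀ ρ {taken} → Dec (∃[ v ] Target ρ taken v) → Board → Partial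
  update ρ (yes (v , _)) c = ρ [ v ]≔ lookup (Clause.signs c) v
  update ρ (no _)        _ = Vec.map just (total ρ)

  decided : History → Partial
  decided start               = Vec.replicate (suc n) nothing
  decided (round h _ (c , _)) = update (decided h) (target? (decided h) (claimed h)) c

  strategy : WaiterStrategy
  strategy h = offer (decided h) (target? (decided h) (claimed h))

  -- Truth under `total ρ` could be lost when a default value is overruled; truth through a decided
  -- variable is permanent.
  record _Forces_ (ρ : Partial) (c : Board) : Set where
    constructor forced
    field
      {var} : Fin (suc n)
      {sign}    : Bool
      occurrence : (var , sign) ∈ᶜ c
      decision   : lookup ρ var ≡ just sign

  forces-mono : ∀ {ρ ρ′ c} → (∀ {i b} → lookup ρ i ≡ just b → lookup ρ′ i ≡ just b) →
                ρ Forces c → ρ′ Forces c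
  forces-mono ρ⊆ρ′ (forced l∈ eq) = forced l∈ (ρ⊆ρ′ eq)

  forces⇒⊨ : ∀ {ρ c} → ρ Forces c → total ρ ⊨ c
  forces⇒⊨ {ρ} (forced l∈ eq) = _ , l∈ , total-just ρ eq

  -- By `settled`, a false clause that is still free has only undecided variables. The value `x` and
  -- the sign `b` are unrelated: `c` need only touch a decided variable.
  record Safe (ρ : Partial) (taken cs : List Board) : Set where
    field
      settled   : ∀ {c i x b} → lookup ρ i ≡ just x → (i , b) ∈ᶜ c → ¬ total ρ ⊨ c → c ∈ taken
      satisfied : All (ρ Forces_) cs

  open Safe

  safe-start : Safe (Vec.replicate (suc n) nothing) [] []
  safe-start .settled {i = i} eq = contradiction (trans (sym (lookup-replicate i nothing)) eq) λ ()
  safe-start .satisfied = []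

  safe-round : ∀ {ρ taken cs} → Safe ρ taken cs →
    (t? : Dec (∃[ v ] Target ρ taken v)) (¬all : ¬ (∀ c → c ∈ taken)) (ch : Choice (offer ρ t? ¬all)) →
    Safe (update ρ t? (proj₁ ch)) (elements (offer ρ t? ¬all) ++ taken) (proj₁ ch ∷ cs)
  safe-round {ρ} {taken} {cs} safe (yes (v , undecided , _)) _ (c , c∈) = go
    where
    ρ′ : Partial
    ρ′ = ρ [ v ]≔ lookup (Clause.signs c) v

    unchanged : ∀ {i} → i ≢ v → lookup ρ′ i ≡ lookup ρ i
    unchanged {i} i≢v = lookup∘updateAt′ i v i≢v ρ

    total-unchanged : ∀ {i} → i ≢ v → lookup (total ρ′) i ≡ lookup (total ρ) i
    total-unchanged {i} i≢v = trans (lookup-map i _ ρ′)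
      (trans (cong (fromMaybe true) (unchanged i≢v)) (sym (lookup-map i _ ρ)))

    decided≢v : ∀ {i x} → lookup ρ i ≡ just x → i ≢ v
    decided≢v eq refl = contradiction (trans (sym undecided) eq) λ ()

    go : Safe ρ′ (batch ρ taken v ++ taken) (c ∷ cs)
    go .settled {d} {i} eq i∈d ρ′⊭d with nothing⊎just (lookup (Clause.signs d) v)
    ... | inj₂ (b , v∈d) with d ∈? taken
    ...   | yes d∈ = ∈-++⁺ʳ (batch ρ taken v) d∈
    -- Away from `v` both completions agree, so all other literals of `d` were already false and `d`
    -- belongs to the batch just offered.
    ...   | no  d∉ = ∈-++⁺ˡ (∈-batch⁺ ρ d∉ (pivotal-complete (total ρ) v d v∈d
              λ j j≢v p → ⊭⇒signs≢ (total ρ′) d ρ′⊭d j (trans p (cong just (sym (total-unchanged j≢v))))))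
    go .settled {d} {i} eq i∈d ρ′⊭d | inj₁ v∉d =
      -- As `d` avoids `v`, neither its truth value nor the decision on `i` has changed in this
      -- round.
      ∈-++⁺ʳ (batch ρ taken v) (settled safe (trans (sym (unchanged (≢v i∈d))) eq) i∈d
        λ { ((j , _) , j∈d , r) → ρ′⊭d ((j , _) , j∈d , trans (total-unchanged (≢v j∈d)) r) })
      where
      ≢v : ∀ {j b} → (j , b) ∈ᶜ d → j ≢ v
      ≢v j∈d refl = contradiction (trans (sym v∉d) j∈d) λ ()
    -- The chosen clause is pivotal, so the entry copied into `ρ′` is a genuine sign. Earlier
    -- forcing variables differ from `v`, which was undecided.
    go .satisfied with b , v∈c ← pivotal-sound (total ρ) v (proj₁ (∈-batch⁻ ρ c∈)) =
      forced v∈c (trans (lookup∘updateAt v ρ) v∈c)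
      ∷ All.map (forces-mono λ eq → trans (unchanged (decided≢v eq)) eq) (satisfied safe)
  safe-round {ρ} {taken} {cs} safe (no ¬target) ¬all (c , here refl) = go
    where
    ρ′ : Partial
    ρ′ = Vec.map just (total ρ)

    lookup-ρ′ : ∀ i → lookup ρ′ i ≡ just (lookup (total ρ) i)
    lookup-ρ′ i = lookup-map i just (total ρ)

    -- Clauses have positive width, so `d` contains some variable. If it is decided, the invariant
    -- applies; if not, an unclaimed `d` would make it a target.
    all-settled : ∀ d → ¬ total ρ ⊨ d → d ∈ taken
    all-settled d ρ⊭d with (i , b) , i∈d ← occurs d with nothing⊎just (lookup ρ i)
    ... | inj₂ (_ , eq)  = settled safe eq i∈d ρ⊭d
    ... | inj₁ undecided = decidable-stable (d ∈? taken) λ d∉ →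
      ¬target (i , undecided , ∈-length (∈-batch⁺ ρ d∉
        (pivotal-complete (total ρ) i d i∈d λ j _ → ⊭⇒signs≢ (total ρ) d ρ⊭d j)))

    go : Safe ρ′ (c ∷ taken) (c ∷ cs)
    go .settled {d} _ _ ρ′⊭d = there (all-settled d λ { ((j , _) , j∈d , r) →
      ρ′⊭d ((j , _) , j∈d , trans (total-just ρ′ (lookup-ρ′ j)) r) })
    go .satisfied with total ρ ⊨? c
    -- The offered clause was free, whereas all false clauses are claimed.
    ... | no ρ⊭c = contradiction (all-settled c ρ⊭c) (proj₂ (freeClause ¬all))
    ... | yes ((i , _) , l∈ , r) = forced l∈ (trans (lookup-ρ′ i) (cong just r))
      ∷ All.map (forces-mono λ eq → trans (lookup-ρ′ _) (cong just (total-just ρ eq))) (satisfied safe)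

  safe-history : ∀ {h} → FollowsWaiter strategy h → Safe (decided h) (claimed h) (clientClaims h)
  safe-history start = safe-start
  safe-history (round {h} follows ¬end c) =
    safe-round (safe-history follows) (target? (decided h) (claimed h)) ¬end c

  waiter-wins : WaiterEnsuresThroughout Satisfiable
  waiter-wins = strategy , λ h follows → total (decided h) ,
    All.map forces⇒⊨ (satisfied (safe-history follows))

-- Binomial arithmetic and the final assembly.

absorption : ∀ n k → suc k * (suc n C suc k) ≡ suc n * (n C k)
absorption zero    zero    = refl
absorption zero    (suc k) =
  trans (cong (suc (suc k) *_) (k>n⇒nCk≡0 {1} {suc (suc k)} (s≤s (s≤s z≤n)))) (*-zeroʳ k)
absorption (suc n) zero    rewrite nC1≡n (suc (suc n)) | nC0≡1 (suc n) = *-comm 1 (suc (suc n))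
absorption (suc n) (suc k) = begin-equality
  suc (suc k) * (suc (suc n) C suc (suc k))       ≡⟨ cong (suc (suc k) *_) (nCk+nC[k+1]≡[n+1]C[k+1] (suc n) (suc k)) ⟨
  -- One copy of `x` is split off so that both induction hypotheses apply; it later raises the
  -- factor n + 1 to n + 2.
  suc (suc k) * (x + y)                           ≡⟨ expand k x y ⟩
  suc k * x + suc (suc k) * y + x                 ≡⟨ cong (_+ x) (cong₂ _+_ (absorption n k) (absorption n (suc k))) ⟩
  suc n * (n C k) + suc n * (n C suc k) + x       ≡⟨ cong (_+ x) (*-distribˡ-+ (suc n) (n C k) (n C suc k)) ⟨
  suc n * (n C k + n C suc k) + x                 ≡⟨ cong (λ z → suc n * z + x) (nCk+nC[k+1]≡[n+1]C[k+1] n k) ⟩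
  suc n * x + x                                   ≡⟨ +-comm (suc n * x) x ⟩
  suc (suc n) * x                                 ∎
  where
  open ≤-Reasoning
  x y : ℕ
  x = suc n C suc k
  y = suc n C suc (suc k)
  expand : ∀ k x y → suc (suc k) * (x + y) ≡ suc k * x + suc (suc k) * y + x
  expand = solve-∀

-- After multiplication by `suc n`, `absorption` expresses the batch size through the binomial
-- coefficient of the hypothesis; what remains is 2 k ≤ 16 k ^ 3, with `suc k` for k.
waiter-room : ∀ k n q → 16 * suc k ^ 3 * (suc n C suc k) ≤ q * suc n → 2 * (n C k) ≤ q
waiter-room k n q bound = *-cancelʳ-≤ _ _ (suc n) (begin
  2 * (n C k) * suc n                   ≡⟨ shape (n C k) (suc n) ⟩
  2 * (suc n * (n C k))                 ≡⟨ cong (2 *_) (absorption n k) ⟨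
  2 * (suc k * x)                       ≡⟨ *-assoc 2 (suc k) x ⟨
  2 * suc k * x                         ≤⟨ *-monoˡ-≤ x (*-mono-≤ {2} {16} (s≤s (s≤s z≤n)) k≤k³) ⟩
  16 * suc k ^ 3 * x                    ≤⟨ bound ⟩
  q * suc n                             ∎)
  where
  open ≤-Reasoning
  x : ℕ
  x = suc n C suc k
  k≤k³ : suc k ≤ suc k ^ 3
  k≤k³ = m≤m*n (suc k) (suc k ^ 2) {{m^n≢0 (suc k) 2}}
  shape : ∀ a b → 2 * a * b ≡ 2 * (b * a)
  shape = solve-∀

theorem1p5 : ∀ (k : ℕ) → 2 ≤ k → ∃[ n₀ ] (∀ (n : ℕ) → n₀ ≤ n → ∀ (q : ℕ) → 1 ≤ q →
    (q * n < n C k → ClientWaiter.ClientEnsuresAtEnd (Clause k n) q (λ cs → ¬ Satisfiable cs))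
    × (16 * k ^ 3 * (n C k) ≤ q * n → ClientWaiter.WaiterEnsuresThroughout (Clause k n) q Satisfiable))
-- The choice `n₀ = 1` makes the number of variables a successor, the form required by `Waiter`.
theorem1p5 (suc k) _ = 1 , λ where
  (suc n) _ q 1≤q →
    client-wins (suc k) (suc n) q 1≤q ,
    λ bound → Waiter.waiter-wins k n q (m≤n⇒m≤n+o 1 (waiter-room k n q bound))
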